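{- Let $\mathcal{L}=(L,\wedge,\vee,*,\rightarrowtail,0,1)$ be a BL-algebra and let $T_*$ be the topology on $L$ consisting of all $*$-open subsets of $L$. Then $(\mathcal{L},T_*)$ is a semitopological BL-algebra.
   Context: A BL-algebra is an algebra $\mathcal{L}=(L,\wedge,\vee,*,\rightarrowtail,0,1)$ of type $(2,2,2,2,0,0)$ such that: (BL1) $(L,\wedge,\vee,0,1)$ is a bounded lattice with greatest element $1$ and smallest element $0$; (BL2) $(L,*,1)$ is an Abelian monoid; (BL3) $c\le a\rightarrowtail b$ iff $c*a\le b$ for all $a,b,c\in L$; (BL4) $a\wedge b=a*(a\rightarrowtail b)$ for all $a,b\in L$; (BL5) $(a\rightarrowtail b)\vee(b\rightarrowtail a)=1$ for all $a,b\in L$. An element $a\in L$ is strongly less than $1$, written $a\ll 1$, if for every $b\in L$, $a\vee b=1$ implies $b=1$. Define $a\leftrightarrow b=(a\rightarrowtail b)*(b\rightarrowtail a)$ for $a,b\in L$. For $a,r\in L$ with $r\ll 1$, the $*$-ball is $B_r(a)=\{b\in L: a\leftrightarrow b>r\}$ (where $x>r$ means $r\le x$ and $r\neq x$). A subset $G\subseteq L$ is $*$-open if for every $a\in G$ there exists $r\in L$ with $r\ll 1$ and $B_r(a)\subseteq G$. The $*$-open subsets of $L$ form a topology $T_*$ on $L$. If $\tau$ is a topology on $L$, then $(\mathcal{L},\tau)$ is called a semitopological BL-algebra if for every $\square\in\{\wedge,\vee,*,\rightarrowtail\}$ and every $\delta\in L$ the maps $\square^\delta_l:(L,\tau)\to(L,\tau)$,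 $\square^\delta_l(x)=\delta\,\square\,x$, and $\square^\delta_r:(L,\tau)\to(L,\tau)$, $\square^\delta_r(x)=x\,\square\,\delta$, are continuous. -}

module Defs where

open import Level using (Level; _⊔_; Lift) renaming (suc to lsuc)
open import Algebra.Core using (Op₂)
open import Algebra.Definitions using (Congruent₂)
open import Algebra.Structures using (IsCommutativeMonoid)
open import Algebra.Lattice.Structures using (IsLattice)
open import Data.Empty using (⊥)
open import Data.Product.Base using (_×_; _,_; ∃; map)
open import Data.Unit.Base using (⊤)
open import Function.Bundles using (Func; _⇔_)
open import Relation.Binary.Bundles using (Setoid)
open import Relation.Binary.Core using (Rel)
open import Relation.Binary.Definitions using (Minimum; Maximum; _Respects_)
import Relation.Binary.Construct.NaturalOrder.Left as NaturalOrder
import Relation.Binary.Construct.NonStrictToStrict as Strict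
open import Relation.Unary using (Pred; _⊆_; _≐_)

private
  variable
    c ℓ c′ ℓ′ p : Level

------------------------------------------------------------------------
-- BL-algebras

-- The carrier is a setoid: _≈_ plays the role of equality of elements.
-- The lattice order is the one determined by ∧, i.e. x ≤ y is
-- x ≈ x ∧ y, and x < y is x ≤ y together with ¬ (x ≈ y).
-- ↣-cong is not an extra axiom: it only says that the operation ↣ is
-- well defined with respect to _≈_.

record BLAlgebra c ℓ : Set (lsuc (c ⊔ ℓ)) where
  infix  4 _≈_
  infixr 5 _↣_
  infixr 6 _∨_
  infixr 7 _∧_
  infixl 8 _*_
  field
    Carrier : Set c
    _≈_     : Rel Carrier ℓ
    _∧_     : Op₂ Carrier
    _∨_     : Op₂ Carrier
    _*_     : Op₂ Carrier
    _↣_     : Op₂ Carrier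
    0#      : Carrier
    1#      : Carrier

  open NaturalOrder _≈_ _∧_ public using (_≤_)
  open Strict _≈_ _≤_ public using (_<_)

  field
    isLattice             : IsLattice _≈_ _∨_ _∧_
    minimum               : Minimum _≤_ 0#
    maximum               : Maximum _≤_ 1#
    *-isCommutativeMonoid : IsCommutativeMonoid _≈_ _*_ 1#
    ↣-cong                : Congruent₂ _≈_ _↣_
    residuated            : ∀ a b c → (c ≤ a ↣ b) ⇔ (c * a ≤ b)
    divisible             : ∀ a b → a ∧ b ≈ a * (a ↣ b)
    prelinear             : ∀ a b → (a ↣ b) ∨ (b ↣ a) ≈ 1#

  open IsLattice isLattice public
    using (isEquivalence; refl; sym; trans; ∧-cong; ∨-cong)
  open IsCommutativeMonoid *-isCommutativeMonoid public
    using () renaming (∙-cong to *-cong)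

  setoid : Setoid c ℓ
  setoid = record { isEquivalence = isEquivalence }

------------------------------------------------------------------------
-- Topologies on a setoid

-- A subset of a setoid is a predicate that does not distinguish
-- equal elements.

record Subset (S : Setoid c ℓ) p : Set (c ⊔ ℓ ⊔ lsuc p) where
  open Setoid S
  field
    mem  : Pred Carrier p
    resp : mem Respects _≈_

open Subset public

module _ {S : Setoid c ℓ} where

  ∅ˢ : Subset S p
  ∅ˢ = record { mem = λ _ → Lift _ ⊥ ; resp = λ _ x∈ → x∈ }

  Uˢ : Subset S p
  Uˢ = record { mem = λ _ → Lift _ ⊤ ; resp = λ _ x∈ → x∈ }

  _∩ˢ_ : Subset S p → Subset S p → Subset S p
  G ∩ˢ H = record
    { mem  = λ x → mem G x × mem H x
    ; resp = λ x≈y → map (resp G x≈y) (resp H x≈y)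
    }

  ⋃ˢ : {I : Set p} → (I → Subset S p) → Subset S p
  ⋃ˢ G = record
    { mem  = λ x → ∃ λ i → mem (G i) x
    ; resp = λ { x≈y (i , x∈Gᵢ) → i , resp (G i) x≈y x∈Gᵢ }
    }

preimage : {S : Setoid c ℓ} {T : Setoid c′ ℓ′} →
           Func S T → Subset T p → Subset S p
preimage f G = record
  { mem  = λ x → mem G (Func.to f x)
  ; resp = λ x≈y → resp G (Func.cong f x≈y)
  }

-- A family of subsets (at predicate level p) is given by the predicate
-- Open; arbitrary unions are unions of indexed families.  Being open
-- depends only on the extension of a subset (≐-open).

record IsTopology {o} (S : Setoid c ℓ) (Open : Pred (Subset S p) o)
                  : Set (c ⊔ ℓ ⊔ lsuc p ⊔ o) where
  field
    ≐-open : ∀ G H → mem G ≐ mem H → Open G → Open H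
    ∅-open : Open ∅ˢ
    U-open : Open Uˢ
    ∩-open : ∀ G H → Open G → Open H → Open (G ∩ˢ H)
    ⋃-open : ∀ {I : Set p} (G : I → Subset S p) →
             (∀ i → Open (G i)) → Open (⋃ˢ G)

Continuous : ∀ {o o′} {S : Setoid c ℓ} {T : Setoid c′ ℓ′} →
             Pred (Subset S p) o → Pred (Subset T p) o′ → Func S T →
             Set (c′ ⊔ ℓ′ ⊔ lsuc p ⊔ o ⊔ o′)
Continuous OpenS OpenT f = ∀ G → OpenT G → OpenS (preimage f G)

------------------------------------------------------------------------
-- The topology T⋆ of ⋆-open subsets

module _ (𝓛 : BLAlgebra c ℓ) where
  open BLAlgebra 𝓛

  infix 4 _≪1

  _≪1 : Pred Carrier (c ⊔ ℓ)
  a ≪1 = ∀ b → a ∨ b ≈ 1# → b ≈ 1#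

  _↔_ : Op₂ Carrier
  a ↔ b = (a ↣ b) * (b ↣ a)

  Ball : Carrier → Carrier → Pred Carrier ℓ
  Ball r a b = r < (a ↔ b)

  T⋆ : ∀ p → Pred (Subset setoid p) (c ⊔ ℓ ⊔ p)
  T⋆ p G = ∀ a → mem G a → ∃ λ r → r ≪1 × Ball r a ⊆ mem G

------------------------------------------------------------------------
-- Semitopological BL-algebras

module _ (𝓛 : BLAlgebra c ℓ) where
  open BLAlgebra 𝓛

  leftTranslation : (_□_ : Op₂ Carrier) → Congruent₂ _≈_ _□_ →
                    Carrier → Func setoid setoid
  leftTranslation _□_ □-cong δ = record
    { to = λ x → δ □ x ; cong = λ x≈y → □-cong refl x≈y }

  rightTranslation : (_□_ : Op₂ Carrier) → Congruent₂ _≈_ _□_ →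
                     Carrier → Func setoid setoid
  rightTranslation _□_ □-cong δ = record
    { to = λ x → x □ δ ; cong = λ x≈y → □-cong x≈y refl }

  SeparatelyContinuous : ∀ {o} → Pred (Subset setoid p) o →
                         (_□_ : Op₂ Carrier) → Congruent₂ _≈_ _□_ →
                         Set (c ⊔ ℓ ⊔ lsuc p ⊔ o)
  SeparatelyContinuous τ _□_ □-cong = ∀ δ →
    Continuous τ τ (leftTranslation _□_ □-cong δ) ×
    Continuous τ τ (rightTranslation _□_ □-cong δ)

  record IsSemitopologicalBLAlgebra {o} (τ : Pred (Subset setoid p) o)
                                    : Set (c ⊔ ℓ ⊔ lsuc p ⊔ o) where
    field
      isTopology   : IsTopology setoid τ
      ∧-continuous : SeparatelyContinuous τ _∧_ ∧-cong
      ∨-continuous : SeparatelyContinuous τ _∨_ ∨-cong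
      *-continuous : SeparatelyContinuous τ _*_ *-cong
      ↣-continuous : SeparatelyContinuous τ _↣_ ↣-cong

-- Every translation f of a BL-algebra satisfies a ↔ b ≤ f a ↔ f b, so it
-- maps the ball of radius r around a into the ball of radius r around f a.
-- This holds because a ↣ b lies below f a ↣ f b, or below f b ↣ f a when
-- f is the antitone map _↣ δ.

{-# OPTIONS --safe #-}
module Submission where

open import Defs
open import Level using (Level; lift)
open import Algebra.Core using (Op₁; Op₂)
open import Algebra.Definitions using (Congruent₂; Commutative)
open import Algebra.Lattice.Bundles using (Lattice)
open import Algebra.Lattice.Structures using (IsLattice)
open import Algebra.Structures using (IsCommutativeMonoid)
import Algebra.Lattice.Properties.Lattice as LatticeProperties
open import Data.Product.Base using (_,_)
open import Function.Bundles using (Func; Equivalence)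
import Relation.Binary.Construct.NonStrictToStrict as Strict
import Relation.Binary.Lattice as OrderTheory
import Relation.Binary.Lattice.Properties.JoinSemilattice as JoinProperties
import Relation.Binary.Reasoning.PartialOrder as ≤-Reasoning

module _ {c ℓ : Level} (𝓛 : BLAlgebra c ℓ) where
  open BLAlgebra 𝓛
  open IsLattice isLattice using (∧-comm; ∨-comm; ∨-assoc)
  open IsCommutativeMonoid *-isCommutativeMonoid
    using () renaming (assoc to *-assoc; comm to *-comm)

  private
    lattice : Lattice c ℓ
    lattice = record { isLattice = isLattice }

    module Order = OrderTheory.Lattice
      (LatticeProperties.∨-∧-orderTheoreticLattice lattice)

    _⇔ᵇ_ : Op₂ Carrier
    _⇔ᵇ_ = _↔_ 𝓛

  open Order using
    ( poset; antisym; reflexive; x≤x∨y; y≤x∨y; ∨-least; x∧y≤x; x∧y≤y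
    ; ∧-greatest; joinSemilattice; ≤-respʳ-≈ )
    renaming (refl to ≤-refl; trans to ≤-trans)
  open JoinProperties joinSemilattice using (x≤y⇒x∨y≈y)
  open ≤-Reasoning poset

  <-≤-trans : ∀ {x y z} → x < y → y ≤ z → x < z
  <-≤-trans = Strict.<-≤-trans _≈_ _≤_ sym ≤-trans antisym ≤-respʳ-≈

  ≤-<-trans : ∀ {x y z} → x ≤ y → y < z → x < z
  ≤-<-trans = Strict.≤-<-trans _≈_ _≤_ ≤-trans antisym Order.≤-respˡ-≈

  residuate : ∀ {a b x} → x * a ≤ b → x ≤ a ↣ b
  residuate = Equivalence.from (residuated _ _ _)

  unresiduate : ∀ {a b x} → x ≤ a ↣ b → x * a ≤ b
  unresiduate = Equivalence.to (residuated _ _ _)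

  modus-ponens : ∀ a b → (a ↣ b) * a ≤ b
  modus-ponens a b = unresiduate ≤-refl

  -- Residuation alone suffices: the chain `x ≤ y ≤ z ↣ (y * z)` is transposed back.
  *-monoˡ : ∀ z {x y} → x ≤ y → x * z ≤ y * z
  *-monoˡ z x≤y = unresiduate (≤-trans x≤y (residuate ≤-refl))

  *-monoʳ : ∀ z {x y} → x ≤ y → z * x ≤ z * y
  *-monoʳ z {x} {y} x≤y = begin
    z * x  ≈⟨ *-comm z x ⟩
    x * z  ≤⟨ *-monoˡ z x≤y ⟩
    y * z  ≈⟨ *-comm y z ⟩
    z * y  ∎

  *-mono : ∀ {x y u v} → x ≤ y → u ≤ v → x * u ≤ y * v
  *-mono x≤y u≤v = ≤-trans (*-monoˡ _ x≤y) (*-monoʳ _ u≤v)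

  -- The monoid unit `1#` is also the greatest element.
  x*y≤y : ∀ x y → x * y ≤ y
  x*y≤y x y = begin
    x * y   ≤⟨ *-monoˡ y (maximum x) ⟩
    1# * y  ≈⟨ IsCommutativeMonoid.identityˡ *-isCommutativeMonoid y ⟩
    y       ∎

  -- After residuation, `(a ↣ b) * (δ ∧ a)` lies below its factor and hence below `δ`, and below `b`
  -- by modus ponens.
  ↣-∧ˡ : ∀ δ a b → a ↣ b ≤ (δ ∧ a) ↣ (δ ∧ b)
  ↣-∧ˡ δ a b = residuate (∧-greatest
    (≤-trans (x*y≤y _ _) (x∧y≤x δ a))
    (≤-trans (*-monoʳ _ (x∧y≤y δ a)) (modus-ponens a b)))

  ↣-∨ˡ : ∀ δ a b → a ↣ b ≤ (δ ∨ a) ↣ (δ ∨ b)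
  ↣-∨ˡ δ a b = residuate (begin
    (a ↣ b) * (δ ∨ a)  ≈⟨ *-comm _ _ ⟩
    -- Moving the factor `a ↣ b` to the right-hand side leaves a bare join on the left, which splits
    -- into cases; in effect `*` distributes over `∨`.
    (δ ∨ a) * (a ↣ b)  ≤⟨ unresiduate (∨-least (residuate δ-case) (residuate a-case)) ⟩
    δ ∨ b              ∎)
    where
    δ-case : δ * (a ↣ b) ≤ δ ∨ b
    δ-case = begin
      δ * (a ↣ b)  ≈⟨ *-comm _ _ ⟩
      (a ↣ b) * δ  ≤⟨ x*y≤y _ _ ⟩
      δ            ≤⟨ x≤x∨y δ b ⟩
      δ ∨ b        ∎

    a-case : a * (a ↣ b) ≤ δ ∨ b
    a-case = begin
      a * (a ↣ b)  ≈⟨ *-comm _ _ ⟩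
      (a ↣ b) * a  ≤⟨ modus-ponens a b ⟩
      b            ≤⟨ y≤x∨y δ b ⟩
      δ ∨ b        ∎

  ↣-*ˡ : ∀ δ a b → a ↣ b ≤ (δ * a) ↣ (δ * b)
  ↣-*ˡ δ a b = residuate (begin
    (a ↣ b) * (δ * a)  ≈⟨ *-cong refl (*-comm δ a) ⟩
    (a ↣ b) * (a * δ)  ≈⟨ *-assoc _ _ _ ⟨
    (a ↣ b) * a * δ    ≤⟨ *-monoˡ δ (modus-ponens a b) ⟩
    b * δ              ≈⟨ *-comm b δ ⟩
    δ * b              ∎)

  -- Two applications of modus ponens. Residuating with respect to one factor or the other yields
  -- the bounds for the two translations of `↣`.
  ↣-compose : ∀ a b d → (b ↣ d) * (a ↣ b) ≤ a ↣ d
  ↣-compose a b d = residuate (begin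
    (b ↣ d) * (a ↣ b) * a    ≈⟨ *-assoc _ _ _ ⟩
    (b ↣ d) * ((a ↣ b) * a)  ≤⟨ *-monoʳ _ (modus-ponens a b) ⟩
    (b ↣ d) * b              ≤⟨ modus-ponens b d ⟩
    d                        ∎)

  ↣-↣ˡ : ∀ δ a b → a ↣ b ≤ (δ ↣ a) ↣ (δ ↣ b)
  ↣-↣ˡ δ a b = residuate (↣-compose δ a b)

  ↣-↣ʳ : ∀ δ a b → a ↣ b ≤ (b ↣ δ) ↣ (a ↣ δ)
  ↣-↣ʳ δ a b = residuate (≤-trans (reflexive (*-comm _ _)) (↣-compose a b δ))

  Nonexpansive : Op₁ Carrier → Set _
  Nonexpansive f = ∀ a b → a ⇔ᵇ b ≤ f a ⇔ᵇ f b

  monotone⇒nonexpansive : ∀ {f} → (∀ a b → a ↣ b ≤ f a ↣ f b) → Nonexpansive f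
  monotone⇒nonexpansive mono a b = *-mono (mono a b) (mono b a)

  -- An antitone `f` swaps the two implications that make up `↔`, and commutativity of `*` swaps
  -- them back.
  antitone⇒nonexpansive : ∀ {f} → (∀ a b → a ↣ b ≤ f b ↣ f a) → Nonexpansive f
  antitone⇒nonexpansive anti a b =
    ≤-trans (*-mono (anti a b) (anti b a)) (reflexive (*-comm _ _))

  0≪1 : _≪1 𝓛 0#
  0≪1 b 0∨b≈1 = trans (sym (x≤y⇒x∨y≈y (minimum b))) 0∨b≈1

  -- Reassociating `(r ∨ s) ∨ b` to `r ∨ (s ∨ b)` lets `r` be cancelled first and then `s`.
  ∨-≪1 : ∀ {r s} → _≪1 𝓛 r → _≪1 𝓛 s → _≪1 𝓛 (r ∨ s)
  ∨-≪1 r≪1 s≪1 b eq = s≪1 b (r≪1 _ (trans (sym (∨-assoc _ _ b)) eq))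

  module _ (p : Level) where

    T⋆-isTopology : IsTopology setoid (T⋆ 𝓛 p)
    T⋆-isTopology = record
      { ≐-open = λ { G H (G⊆H , H⊆G) G-open a a∈H →
          let r , r≪1 , ball⊆G = G-open a (H⊆G a∈H)
          in r , r≪1 , λ b∈ball → G⊆H (ball⊆G b∈ball) }
      ; ∅-open = λ { _ (lift ()) }
      -- Any radius strongly less than 1 would do; `0#` is one in every BL-algebra.
      ; U-open = λ _ _ → 0# , 0≪1 , λ _ → _
      ; ∩-open = λ { G H G-open H-open a (a∈G , a∈H) →
          let r , r≪1 , ball⊆G = G-open a a∈G
              s , s≪1 , ball⊆H = H-open a a∈H
          -- A larger radius gives a smaller ball, so the join of the radii serves both sets.
          in r ∨ s , ∨-≪1 r≪1 s≪1 , λ b∈ball →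
               ball⊆G (≤-<-trans (x≤x∨y r s) b∈ball) ,
               ball⊆H (≤-<-trans (y≤x∨y r s) b∈ball) }
      ; ⋃-open = λ { G G-open a (i , a∈Gᵢ) →
          let r , r≪1 , ball⊆Gᵢ = G-open i a a∈Gᵢ
          in r , r≪1 , λ b∈ball → i , ball⊆Gᵢ b∈ball }
      }

    nonexpansive⇒continuous : (f : Func setoid setoid) →
      Nonexpansive (Func.to f) → Continuous (T⋆ 𝓛 p) (T⋆ 𝓛 p) f
    nonexpansive⇒continuous f nonexp G G-open a fa∈G =
      let r , r≪1 , ball⊆G = G-open (Func.to f a) fa∈G
      in r , r≪1 , λ b∈ball → ball⊆G (<-≤-trans b∈ball (nonexp a _))

    -- Covers `∧`, `∨` and `*` at once: commutativity turns the bound for left translations into the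
    -- one for right translations.
    commutative⇒separatelyContinuous :
      ∀ (_□_ : Op₂ Carrier) (□-cong : Congruent₂ _≈_ _□_) → Commutative _≈_ _□_ →
      (∀ δ a b → a ↣ b ≤ (δ □ a) ↣ (δ □ b)) →
      SeparatelyContinuous 𝓛 (T⋆ 𝓛 p) _□_ □-cong
    commutative⇒separatelyContinuous _□_ □-cong □-comm mono δ =
      nonexpansive⇒continuous (leftTranslation 𝓛 _□_ □-cong δ)
        (monotone⇒nonexpansive (mono δ)) ,
      nonexpansive⇒continuous (rightTranslation 𝓛 _□_ □-cong δ)
        (monotone⇒nonexpansive λ a b →
          ≤-respʳ-≈ (↣-cong (□-comm δ a) (□-comm δ b)) (mono δ a b))

    T⋆-isSemitopological : IsSemitopologicalBLAlgebra 𝓛 (T⋆ 𝓛 p)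
    T⋆-isSemitopological = record
      { isTopology   = T⋆-isTopology
      ; ∧-continuous = commutative⇒separatelyContinuous _∧_ ∧-cong ∧-comm ↣-∧ˡ
      ; ∨-continuous = commutative⇒separatelyContinuous _∨_ ∨-cong ∨-comm ↣-∨ˡ
      ; *-continuous = commutative⇒separatelyContinuous _*_ *-cong *-comm ↣-*ˡ
      ; ↣-continuous = λ δ →
          nonexpansive⇒continuous (leftTranslation 𝓛 _↣_ ↣-cong δ)
            (monotone⇒nonexpansive (↣-↣ˡ δ)) ,
          nonexpansive⇒continuous (rightTranslation 𝓛 _↣_ ↣-cong δ)
            (antitone⇒nonexpansive (↣-↣ʳ δ))
      }

theorem3p11 : ∀ {c ℓ : Level} (𝓛 : BLAlgebra c ℓ) (p : Level) →
    IsSemitopologicalBLAlgebra 𝓛 (T⋆ 𝓛 p)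
theorem3p11 = T⋆-isSemitopological
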